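{- Let $\{F_x : x\in V(G)\}$ be a representation of a restricted frame graph $G$. For every induced cycle $C$ of $G$ there is a vertex $v\in V(C)$ such that $F_v$ contains the frame of every vertex in $V(C)\setminus N[v]$. Moreover, if $u\in V(C)$, $u\neq v$, is another vertex such that $F_u$ contains the frame of every vertex in $V(C)\setminus N[u]$, then $u$ is adjacent to $v$.
   Context: $N[v]=\{v\}\cup N(v)$. A frame is the boundary of an axis-parallel box $[a,b]\times[c,d]\subset\mathbb R^2$ ($a<b$, $c<d$). A representation of $G$ as a restricted frame graph is a family $\{F_x\}$ of frames with $xy\in E(G)$ iff $F_x\cap F_y\neq\emptyset$ ($x\ne y$), such that: (1) no corner of a frame lies on another frame; (2) the left side of any frame meets no other frame; (3) if the right side of a frame meets a second frame, it meets both the top and bottom sides of the second frame; (4) if two frames intersect, no frame is entirely contained in the intersection of the closed regions bounded by them. A frame $F_1$ contains a frame $F_2$ if $F_1\cap F_2=\emptyset$ and $F_2$ lies in the region bounded by $F_1$. -}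

module Defs where

open import Level using (_⊔_)
open import Data.Nat using (ℕ; suc; _+_; _%_)
open import Data.Fin using (Fin; toℕ)
open import Data.Product using (_×_; _,_; ∃)
open import Data.Sum using (_⊎_)
open import Relation.Nullary using (¬_)
open import Relation.Binary.PropositionalEquality using (_≡_; _≢_)
open import Relation.Binary.Bundles using (StrictTotalOrder)
open import Function.Bundles using (_⇔_)

-- Coordinates are taken in an arbitrary strict total order (ℝ with < is an
-- instance).  All notions below only use the order of coordinates.
module FrameDefs {c ℓ₁ ℓ₂} (O : StrictTotalOrder c ℓ₁ ℓ₂) where

  open StrictTotalOrder O renaming (Carrier to A)

  _⊑_ : A → A → Set (ℓ₁ ⊔ ℓ₂)
  x ⊑ y = (x < y) ⊎ (x ≈ y)

  Between : A → A → A → Set (ℓ₁ ⊔ ℓ₂)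
  Between lo x hi = (lo ⊑ x) × (x ⊑ hi)

  -- the box [a,b] × [c,d] with a < b, c < d; the frame is its boundary
  record Frame : Set (c ⊔ ℓ₂) where
    field
      left right bottom top : A
      left<right : left < right
      bottom<top : bottom < top

  Point : Set c
  Point = A × A

  PointSet : Set _
  PointSet = Point → Set (ℓ₁ ⊔ ℓ₂)

  module _ (F : Frame) where
    open Frame F

    LeftSide : PointSet
    LeftSide (x , y) = (x ≈ left) × Between bottom y top

    RightSide : PointSet
    RightSide (x , y) = (x ≈ right) × Between bottom y top

    BottomSide : PointSet
    BottomSide (x , y) = (y ≈ bottom) × Between left x right

    TopSide : PointSet
    TopSide (x , y) = (y ≈ top) × Between left x right

    OnFrame : PointSet
    OnFrame p = LeftSide p ⊎ RightSide p ⊎ BottomSide p ⊎ TopSide p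

    InRegion : PointSet
    InRegion (x , y) = Between left x right × Between bottom y top

    IsCorner : Point → Set ℓ₁
    IsCorner (x , y) = ((x ≈ left) ⊎ (x ≈ right)) × ((y ≈ bottom) ⊎ (y ≈ top))

  Meets : PointSet → PointSet → Set _
  Meets S T = ∃ λ p → S p × T p

  Intersect : Frame → Frame → Set _
  Intersect F G = Meets (OnFrame F) (OnFrame G)

  Contains : Frame → Frame → Set _
  Contains F₁ F₂ = ¬ Intersect F₁ F₂ × (∀ p → OnFrame F₂ p → InRegion F₁ p)

  module _ {n : ℕ} (F : Fin n → Frame) where

    -- the graph G represented by the family: vertices Fin n
    Adj : Fin n → Fin n → Set _
    Adj x y = (x ≢ y) × Intersect (F x) (F y)

    ClosedNbr : Fin n → Fin n → Set _
    ClosedNbr v u = (u ≡ v) ⊎ Adj v u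

    record Restricted : Set (c ⊔ ℓ₁ ⊔ ℓ₂) where
      field
        cond1 : ∀ x y → x ≢ y → ∀ p → IsCorner (F x) p → ¬ OnFrame (F y) p
        cond2 : ∀ x y → x ≢ y → ¬ Meets (LeftSide (F x)) (OnFrame (F y))
        cond3 : ∀ x y → x ≢ y → Meets (RightSide (F x)) (OnFrame (F y)) →
                Meets (RightSide (F x)) (TopSide (F y)) ×
                Meets (RightSide (F x)) (BottomSide (F y))
        cond4 : ∀ x y → x ≢ y → Intersect (F x) (F y) →
                ∀ z → ¬ (∀ p → OnFrame (F z) p →
                          InRegion (F x) p × InRegion (F y) p)

    CycNext : ∀ {k} → Fin (suc k) → Fin (suc k) → Set
    CycNext {k} i j = toℕ j ≡ (toℕ i + 1) % suc k

    record IsInducedCycle (m : ℕ) (cyc : Fin (3 + m) → Fin n) : Set (c ⊔ ℓ₁ ⊔ ℓ₂) where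
      field
        distinct : ∀ i j → cyc i ≡ cyc j → i ≡ j
        induced  : ∀ i j → Adj (cyc i) (cyc j) ⇔ (CycNext i j ⊎ CycNext j i)

    ContainsNonNbrs : (m : ℕ) (cyc : Fin (3 + m) → Fin n) → Fin (3 + m) → Set _
    ContainsNonNbrs m cyc i =
      ∀ j → ¬ ClosedNbr (cyc i) (cyc j) → Contains (F (cyc i)) (F (cyc j))

module Submission where

-- For disjoint frames X, Z, a single point of
-- Z inside the closed region of X already forces X to contain Z.  Consequently
-- containment propagates along intersecting frames that avoid the container,
-- containment is asymmetric, and disjoint frames whose regions share a point
-- are nested.  Conditions (1)-(3) imply: if
-- F p meets F r and reaches no further right, then the lower-left corner of
-- F r lies in the region of F p.
-- The cycle (module InducedCycle).  Let r be the vertex of C whose frame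
-- reaches furthest right, p its predecessor and s its successor on C.  Both
-- regions of F p and F s contain the lower-left corner of F r, and p, s are
-- non-adjacent when C has length ≥ 4, so one of F p, F s contains the other.
-- That containment spreads along the arc of C avoiding the outer vertex, which
-- therefore qualifies.  Two non-adjacent qualifying vertices would contain each
-- other, which asymmetry forbids.

open import Defs
open import Data.Nat using (ℕ; suc; _+_)
open import Data.Fin using (Fin; zero; toℕ; fromℕ<)
open import Data.Fin.Properties using (toℕ-injective; toℕ-fromℕ<; toℕ<n)
open import Data.List using (allFin)
open import Data.List.Membership.Propositional.Properties using (∈-allFin)
import Data.List.Relation.Unary.All as All
open import Data.Product using (_×_; _,_; ∃; proj₁; proj₂; swap)
open import Data.Sum using (_⊎_; inj₁; inj₂; [_,_]′)
open import Data.Empty using (⊥; ⊥-elim)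
open import Function using (_∘_)
open import Function.Bundles using (Equivalence)
open import Relation.Nullary using (¬_; yes; no)
open import Relation.Binary.PropositionalEquality
  using (_≡_; _≢_; refl; sym; trans; cong; subst; ≢-sym; module ≡-Reasoning)
open import Relation.Binary.Bundles using (StrictTotalOrder)
open import Relation.Binary.Definitions using (tri<; tri≈; tri>)
import Relation.Binary.Construct.StrictToNonStrict as StrictToNonStrict

module Interval where
  open import Data.Nat using (_≤_; _<_; _≤′_; ≤′-refl; ≤′-step)
  open import Data.Nat.Properties using (≤⇒≤′; ≤′⇒≤; <⇒≤; ≤-refl; ≤-trans; m<n⇒m<1+n)

  interval-up : ∀ {ℓ} (P : ℕ → Set ℓ) {a b} → P a →
                (∀ {k} → a ≤ k → k < b → P k → P (suc k)) →
                ∀ k → a ≤ k → k ≤ b → P k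
  interval-up P {a} {b} Pa step k a≤k k≤b = go (≤⇒≤′ a≤k) k≤b
    where
    go : ∀ {k} → a ≤′ k → k ≤ b → P k
    go ≤′-refl _ = Pa
    go (≤′-step a≤′k) k<b = step (≤′⇒≤ a≤′k) k<b (go a≤′k (<⇒≤ k<b))

  interval-down : ∀ {ℓ} (P : ℕ → Set ℓ) {a b} → P b →
                  (∀ {k} → a ≤ k → k < b → P (suc k) → P k) →
                  ∀ k → a ≤ k → k ≤ b → P k
  interval-down P {a} Pb step k a≤k k≤b = go (≤⇒≤′ k≤b) Pb step
    where
    go : ∀ {c} → k ≤′ c → P c → (∀ {j} → a ≤ j → j < c → P (suc j) → P j) → P k
    go ≤′-refl Pk _ = Pk
    go (≤′-step k≤′c) Psc stepc =
      go k≤′c (stepc (≤-trans a≤k (≤′⇒≤ k≤′c)) ≤-refl Psc)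
         (λ a≤j j<c → stepc a≤j (m<n⇒m<1+n j<c))

module CyclicShift {K : ℕ} where
  open import Data.Nat using (_∸_; _%_; _<_)
  open import Data.Nat.Properties
    using (<⇒≤; +-comm; +-assoc; +-identityʳ; m+[n∸m]≡n; +-commutativeSemigroup)
  open import Data.Nat.DivMod using (m%n<n; %-distribˡ-+; m%n%n≡m%n; [m+n]%n≡m%n; m<n⇒m%n≡m)
  open import Algebra.Properties.CommutativeSemigroup +-commutativeSemigroup using (x∙yz≈y∙xz)
  open ≡-Reasoning

  private
    N : ℕ
    N = suc K

  _⊕_ : Fin N → ℕ → Fin N
  x ⊕ k = fromℕ< (m%n<n (toℕ x + k) N)

  toℕ-⊕ : ∀ x k → toℕ (x ⊕ k) ≡ (toℕ x + k) % N
  toℕ-⊕ x k = toℕ-fromℕ< (m%n<n (toℕ x + k) N)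

  %-absorbˡ : ∀ a b → (a % N + b) % N ≡ (a + b) % N
  %-absorbˡ a b = begin
    (a % N + b) % N          ≡⟨ %-distribˡ-+ (a % N) b N ⟩
    (a % N % N + b % N) % N  ≡⟨ cong (λ z → (z + b % N) % N) (m%n%n≡m%n a N) ⟩
    (a % N + b % N) % N      ≡⟨ %-distribˡ-+ a b N ⟨
    (a + b) % N              ∎

  %-absorbʳ : ∀ a b → (a + b % N) % N ≡ (a + b) % N
  %-absorbʳ a b = begin
    (a + b % N) % N  ≡⟨ cong (_% N) (+-comm a (b % N)) ⟩
    (b % N + a) % N  ≡⟨ %-absorbˡ b a ⟩
    (b + a) % N      ≡⟨ cong (_% N) (+-comm b a) ⟩
    (a + b) % N      ∎

  ⊕-assoc : ∀ x k l → (x ⊕ k) ⊕ l ≡ x ⊕ (k + l)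
  ⊕-assoc x k l = toℕ-injective (begin
    toℕ ((x ⊕ k) ⊕ l)          ≡⟨ toℕ-⊕ (x ⊕ k) l ⟩
    (toℕ (x ⊕ k) + l) % N      ≡⟨ cong (λ z → (z + l) % N) (toℕ-⊕ x k) ⟩
    ((toℕ x + k) % N + l) % N  ≡⟨ %-absorbˡ (toℕ x + k) l ⟩
    (toℕ x + k + l) % N        ≡⟨ cong (_% N) (+-assoc (toℕ x) k l) ⟩
    (toℕ x + (k + l)) % N      ≡⟨ toℕ-⊕ x (k + l) ⟨
    toℕ (x ⊕ (k + l))          ∎)

  ⊕-suc : ∀ x k → (x ⊕ k) ⊕ 1 ≡ x ⊕ suc k
  ⊕-suc x k = trans (⊕-assoc x k 1) (cong (x ⊕_) (+-comm k 1))

  ⊕-identityʳ : ∀ x → x ⊕ 0 ≡ x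
  ⊕-identityʳ x = toℕ-injective (begin
    toℕ (x ⊕ 0)      ≡⟨ toℕ-⊕ x 0 ⟩
    (toℕ x + 0) % N  ≡⟨ cong (_% N) (+-identityʳ (toℕ x)) ⟩
    toℕ x % N        ≡⟨ m<n⇒m%n≡m (toℕ<n x) ⟩
    toℕ x            ∎)

  ⊕-pred : ∀ x → (x ⊕ K) ⊕ 1 ≡ x
  ⊕-pred x = trans (⊕-suc x K) (toℕ-injective (begin
    toℕ (x ⊕ N)      ≡⟨ toℕ-⊕ x N ⟩
    (toℕ x + N) % N  ≡⟨ [m+n]%n≡m%n (toℕ x) N ⟩
    toℕ x % N        ≡⟨ m<n⇒m%n≡m (toℕ<n x) ⟩
    toℕ x            ∎))

  offset : Fin N → Fin N → ℕ
  offset x j = toℕ (j ⊕ (N ∸ toℕ x))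

  offset<N : ∀ x j → offset x j < N
  offset<N x j = toℕ<n (j ⊕ (N ∸ toℕ x))

  forward-back : ∀ x k → (toℕ x + (k + (N ∸ toℕ x))) % N ≡ k % N
  forward-back x k = begin
    (toℕ x + (k + (N ∸ toℕ x))) % N  ≡⟨ cong (_% N) (x∙yz≈y∙xz (toℕ x) k (N ∸ toℕ x)) ⟩
    (k + (toℕ x + (N ∸ toℕ x))) % N  ≡⟨ cong (λ z → (k + z) % N) (m+[n∸m]≡n (<⇒≤ (toℕ<n x))) ⟩
    (k + N) % N                      ≡⟨ [m+n]%n≡m%n k N ⟩
    k % N                            ∎

  ⊕-offset : ∀ x j → x ⊕ offset x j ≡ j
  ⊕-offset x j = toℕ-injective (begin
    toℕ (x ⊕ offset x j)                          ≡⟨ toℕ-⊕ x (offset x j) ⟩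
    (toℕ x + offset x j) % N                      ≡⟨ cong (λ z → (toℕ x + z) % N) (toℕ-⊕ j (N ∸ toℕ x)) ⟩
    (toℕ x + (toℕ j + (N ∸ toℕ x)) % N) % N       ≡⟨ %-absorbʳ (toℕ x) (toℕ j + (N ∸ toℕ x)) ⟩
    (toℕ x + (toℕ j + (N ∸ toℕ x))) % N           ≡⟨ forward-back x (toℕ j) ⟩
    toℕ j % N                                     ≡⟨ m<n⇒m%n≡m (toℕ<n j) ⟩
    toℕ j                                         ∎)

  offset-⊕ : ∀ x k → k < N → offset x (x ⊕ k) ≡ k
  offset-⊕ x k k<N = begin
    toℕ ((x ⊕ k) ⊕ (N ∸ toℕ x))        ≡⟨ cong toℕ (⊕-assoc x k (N ∸ toℕ x)) ⟩
    toℕ (x ⊕ (k + (N ∸ toℕ x)))        ≡⟨ toℕ-⊕ x (k + (N ∸ toℕ x)) ⟩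
    (toℕ x + (k + (N ∸ toℕ x))) % N    ≡⟨ forward-back x k ⟩
    k % N                              ≡⟨ m<n⇒m%n≡m k<N ⟩
    k                                  ∎

  ⊕-injective : ∀ x {k l} → k < N → l < N → x ⊕ k ≡ x ⊕ l → k ≡ l
  ⊕-injective x {k} {l} k<N l<N e =
    trans (sym (offset-⊕ x k k<N)) (trans (cong (offset x) e) (offset-⊕ x l l<N))

module FrameGeometry {c ℓ₁ ℓ₂} (O : StrictTotalOrder c ℓ₁ ℓ₂) where
  open StrictTotalOrder O
    using (_<_; _≈_; compare; irrefl; <-resp-≈; module Eq) renaming (Carrier to A; trans to <-trans)
  open FrameDefs O
  open import Relation.Binary.Properties.StrictTotalOrder O
    using () renaming (refl to ⊑-refl; trans to ⊑-trans; antisym to ⊑-antisym;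
                       total to ⊑-total; reflexive to ≈⇒⊑)
  open Frame public using (left; right; bottom; top)

  <⇒⊑ : ∀ {x y} → x < y → x ⊑ y
  <⇒⊑ = inj₁

  <-⊑-trans : ∀ {x y z} → x < y → y ⊑ z → x < z
  <-⊑-trans = StrictToNonStrict.<-≤-trans _≈_ _<_ <-trans (proj₁ <-resp-≈)

  ⊑-<-trans : ∀ {x y z} → x ⊑ y → y < z → x < z
  ⊑-<-trans = StrictToNonStrict.≤-<-trans _≈_ _<_ Eq.sym <-trans (proj₂ <-resp-≈)

  <⇒⋣ : ∀ {x y} → x < y → ¬ (y ⊑ x)
  <⇒⋣ x<y y⊑x = irrefl Eq.refl (⊑-<-trans y⊑x x<y)

  <-or-⊒ : ∀ x y → (x < y) ⊎ (y ⊑ x)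
  <-or-⊒ x y with compare x y
  ... | tri< x<y _ _ = inj₁ x<y
  ... | tri≈ _ x≈y _ = inj₂ (≈⇒⊑ (Eq.sym x≈y))
  ... | tri> _ _ y<x = inj₂ (<⇒⊑ y<x)

  left⊑right : ∀ F → left F ⊑ right F
  left⊑right F = <⇒⊑ (Frame.left<right F)

  bottom⊑top : ∀ F → bottom F ⊑ top F
  bottom⊑top F = <⇒⊑ (Frame.bottom<top F)

  intersect-sym : ∀ {X Y} → Intersect X Y → Intersect Y X
  intersect-sym (q , onX , onY) = q , onY , onX

  onBottom : ∀ F {x} → Between (left F) x (right F) → OnFrame F (x , bottom F)
  onBottom F x∈F = inj₂ (inj₂ (inj₁ (Eq.refl , x∈F)))

  onTop : ∀ F {x} → Between (left F) x (right F) → OnFrame F (x , top F)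
  onTop F x∈F = inj₂ (inj₂ (inj₂ (Eq.refl , x∈F)))

  onRight : ∀ F {y} → Between (bottom F) y (top F) → OnFrame F (right F , y)
  onRight F y∈F = inj₂ (inj₁ (Eq.refl , y∈F))

  lowerLeft : ∀ F → OnFrame F (left F , bottom F)
  lowerLeft F = inj₁ (Eq.refl , (⊑-refl , bottom⊑top F))

  onVertical : ∀ F {x y} → (x ≈ left F) ⊎ (x ≈ right F) →
               Between (bottom F) y (top F) → OnFrame F (x , y)
  onVertical F (inj₁ x≈l) y∈F = inj₁ (x≈l , y∈F)
  onVertical F (inj₂ x≈r) y∈F = inj₂ (inj₁ (x≈r , y∈F))

  HorizontalSide : Frame → PointSet
  HorizontalSide F q = BottomSide F q ⊎ TopSide F q

  horizontal-height : ∀ F {x y} → HorizontalSide F (x , y) → (y ≈ bottom F) ⊎ (y ≈ top F)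
  horizontal-height F (inj₁ (y≈b , _)) = inj₁ y≈b
  horizontal-height F (inj₂ (y≈t , _)) = inj₂ y≈t

  horizontal-span : ∀ F {x y} → HorizontalSide F (x , y) → Between (left F) x (right F)
  horizontal-span F (inj₁ (_ , x∈F)) = x∈F
  horizontal-span F (inj₂ (_ , x∈F)) = x∈F

  onHorizontal : ∀ F {x y} → (y ≈ bottom F) ⊎ (y ≈ top F) →
                 Between (left F) x (right F) → OnFrame F (x , y)
  onHorizontal F (inj₁ y≈b) x∈F = inj₂ (inj₂ (inj₁ (y≈b , x∈F)))
  onHorizontal F (inj₂ y≈t) x∈F = inj₂ (inj₂ (inj₂ (y≈t , x∈F)))

  frame⊆region : ∀ F {q} → OnFrame F q → InRegion F q
  frame⊆region F (inj₁ (x≈l , y∈F)) =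
    (≈⇒⊑ (Eq.sym x≈l) , ⊑-trans (≈⇒⊑ x≈l) (left⊑right F)) , y∈F
  frame⊆region F (inj₂ (inj₁ (x≈r , y∈F))) =
    (⊑-trans (left⊑right F) (≈⇒⊑ (Eq.sym x≈r)) , ≈⇒⊑ x≈r) , y∈F
  frame⊆region F (inj₂ (inj₂ (inj₁ (y≈b , x∈F)))) =
    x∈F , (≈⇒⊑ (Eq.sym y≈b) , ⊑-trans (≈⇒⊑ y≈b) (bottom⊑top F))
  frame⊆region F (inj₂ (inj₂ (inj₂ (y≈t , x∈F)))) =
    x∈F , (⊑-trans (bottom⊑top F) (≈⇒⊑ (Eq.sym y≈t)) , ≈⇒⊑ y≈t)

  -- reflection in the diagonal swaps the roles of the two coordinates; it lets
  -- the vertical bounds below be read off from the horizontal ones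
  transpose : Frame → Frame
  transpose F = record { left = bottom F ; right = top F ; bottom = left F ; top = right F
                       ; left<right = Frame.bottom<top F ; bottom<top = Frame.left<right F }

  onFrame-transpose : ∀ F {q} → OnFrame F q → OnFrame (transpose F) (swap q)
  onFrame-transpose F (inj₁ onL) = inj₂ (inj₂ (inj₁ onL))
  onFrame-transpose F (inj₂ (inj₁ onR)) = inj₂ (inj₂ (inj₂ onR))
  onFrame-transpose F (inj₂ (inj₂ (inj₁ onB))) = inj₁ onB
  onFrame-transpose F (inj₂ (inj₂ (inj₂ onT))) = inj₂ (inj₁ onT)

  disjoint-transpose : ∀ X Z → ¬ Intersect X Z → ¬ Intersect (transpose X) (transpose Z)
  disjoint-transpose X Z disj (q , onX , onZ) =
    disj (swap q , onFrame-transpose (transpose X) onX , onFrame-transpose (transpose Z) onZ)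

  -- Let X, Z be disjoint and q a point of Z in the region of X.  A vertical
  -- side of X cannot have its abscissa in the horizontal range of Z: it would
  -- cross the bottom or the top of Z, unless Z sticks out of X both below and
  -- above; then q lies on a vertical side of Z, which crosses the top of X.
  vertical-side-outside : ∀ X Z {q a} → ¬ Intersect X Z → OnFrame Z q → InRegion X q →
                          (a ≈ left X) ⊎ (a ≈ right X) → ¬ Between (left Z) a (right Z)
  vertical-side-outside X Z {q₁ , q₂} disj onZ (q₁∈X , (bX⊑q₂ , q₂⊑tX)) side a∈Z
    with <-or-⊒ (bottom Z) (bottom X) | <-or-⊒ (top X) (top Z)
  ... | inj₂ bX⊑bZ | _ =
    disj (_ , onVertical X side (bX⊑bZ , ⊑-trans bZ⊑q₂ q₂⊑tX) , onBottom Z a∈Z)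
    where bZ⊑q₂ = proj₁ (proj₂ (frame⊆region Z onZ))
  ... | inj₁ _ | inj₂ tZ⊑tX =
    disj (_ , onVertical X side (⊑-trans bX⊑q₂ q₂⊑tZ , tZ⊑tX) , onTop Z a∈Z)
    where q₂⊑tZ = proj₂ (proj₂ (frame⊆region Z onZ))
  ... | inj₁ bZ<bX | inj₁ tX<tZ =
    disj (_ , onTop X q₁∈X ,
          onVertical Z (on-vertical-side onZ)
            (<⇒⊑ (<-⊑-trans bZ<bX (bottom⊑top X)) , <⇒⊑ tX<tZ))
    where
    on-vertical-side : OnFrame Z (q₁ , q₂) → (q₁ ≈ left Z) ⊎ (q₁ ≈ right Z)
    on-vertical-side (inj₁ (q₁≈l , _)) = inj₁ q₁≈l
    on-vertical-side (inj₂ (inj₁ (q₁≈r , _))) = inj₂ q₁≈r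
    on-vertical-side (inj₂ (inj₂ (inj₁ (q₂≈b , _)))) =
      ⊥-elim (<⇒⋣ bZ<bX (⊑-trans bX⊑q₂ (≈⇒⊑ q₂≈b)))
    on-vertical-side (inj₂ (inj₂ (inj₂ (q₂≈t , _)))) =
      ⊥-elim (<⇒⋣ tX<tZ (⊑-trans (≈⇒⊑ (Eq.sym q₂≈t)) q₂⊑tX))

  left-bound : ∀ X Z {q} → ¬ Intersect X Z → OnFrame Z q → InRegion X q → left X ⊑ left Z
  left-bound X Z disj onZ q∈X with <-or-⊒ (left Z) (left X)
  ... | inj₂ lX⊑lZ = lX⊑lZ
  ... | inj₁ lZ<lX = ⊥-elim (vertical-side-outside X Z disj onZ q∈X (inj₁ Eq.refl)
                       (<⇒⊑ lZ<lX , ⊑-trans (proj₁ (proj₁ q∈X)) (proj₂ (proj₁ (frame⊆region Z onZ)))))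

  right-bound : ∀ X Z {q} → ¬ Intersect X Z → OnFrame Z q → InRegion X q → right Z ⊑ right X
  right-bound X Z disj onZ q∈X with <-or-⊒ (right X) (right Z)
  ... | inj₂ rZ⊑rX = rZ⊑rX
  ... | inj₁ rX<rZ = ⊥-elim (vertical-side-outside X Z disj onZ q∈X (inj₂ Eq.refl)
                       (⊑-trans (proj₁ (proj₁ (frame⊆region Z onZ))) (proj₂ (proj₁ q∈X)) , <⇒⊑ rX<rZ))

  contains-if-inside : ∀ X Z {q} → ¬ Intersect X Z → OnFrame Z q → InRegion X q → Contains X Z
  contains-if-inside X Z disj onZ q∈X = disj , λ p onZp →
    let ((lZ⊑x , x⊑rZ) , (bZ⊑y , y⊑tZ)) = frame⊆region Z onZp in
    (⊑-trans lX⊑lZ lZ⊑x , ⊑-trans x⊑rZ rZ⊑rX) , (⊑-trans bX⊑bZ bZ⊑y , ⊑-trans y⊑tZ tZ⊑tX)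
    where
    disjᵀ = disjoint-transpose X Z disj
    onZᵀ = onFrame-transpose Z onZ
    lX⊑lZ = left-bound X Z disj onZ q∈X
    rZ⊑rX = right-bound X Z disj onZ q∈X
    bX⊑bZ = left-bound (transpose X) (transpose Z) disjᵀ onZᵀ (swap q∈X)
    tZ⊑tX = right-bound (transpose X) (transpose Z) disjᵀ onZᵀ (swap q∈X)

  contains-along : ∀ X Z Z′ → Contains X Z → Intersect Z Z′ → ¬ Intersect X Z′ → Contains X Z′
  contains-along X Z Z′ (_ , Z⊆X) (q , onZ , onZ′) disj = contains-if-inside X Z′ disj onZ′ (Z⊆X q onZ)

  -- containment is asymmetric: mutual containment forces equal left sides,
  -- which then meet
  contains-asym : ∀ X Z → Contains X Z → ¬ Contains Z X
  contains-asym X Z (disj , Z⊆X) (_ , X⊆Z) =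
    disj (_ , lowerLeft X , inj₁ (lX≈lZ , proj₂ cornerX∈Z))
    where
    cornerX∈Z = X⊆Z _ (lowerLeft X)
    lX≈lZ = ⊑-antisym (proj₁ (proj₁ (Z⊆X _ (lowerLeft Z)))) (proj₁ (proj₁ cornerX∈Z))

  -- for disjoint frames with a common point q of their regions, the point of
  -- Y's right side at the height of q lies in the region of X if Y is narrower
  contains-narrower : ∀ X Y {q} → ¬ Intersect X Y → InRegion X q → InRegion Y q →
                      right Y ⊑ right X → Contains X Y
  contains-narrower X Y disj ((lX⊑x , _) , y∈X) ((_ , x⊑rY) , y∈Y) rY⊑rX =
    contains-if-inside X Y disj (onRight Y y∈Y) ((⊑-trans lX⊑x x⊑rY , rY⊑rX) , y∈X)

  nested : ∀ X Y {q} → ¬ Intersect X Y → InRegion X q → InRegion Y q → Contains X Y ⊎ Contains Y X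
  nested X Y disj q∈X q∈Y with ⊑-total (right Y) (right X)
  ... | inj₁ rY⊑rX = inj₁ (contains-narrower X Y disj q∈X q∈Y rY⊑rX)
  ... | inj₂ rX⊑rY = inj₂ (contains-narrower Y X (disj ∘ intersect-sym {Y} {X}) q∈Y q∈X rX⊑rY)

module RestrictedFrames {c ℓ₁ ℓ₂} (O : StrictTotalOrder c ℓ₁ ℓ₂) {n : ℕ}
                        (F : Fin n → FrameDefs.Frame O) (res : FrameDefs.Restricted O F) where
  open StrictTotalOrder O using (module Eq)
  open FrameDefs O
  open FrameGeometry O
  open import Relation.Binary.Properties.StrictTotalOrder O
    using () renaming (trans to ⊑-trans; antisym to ⊑-antisym; total to ⊑-total; reflexive to ≈⇒⊑)
  open Restricted res

  -- if horizontal sides of F r and F p share a point and F r's side starts no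
  -- further left, then F r's corner at that height lies on F p, against (1)
  corner-on-horizontal : ∀ r p {q} → r ≢ p → left (F p) ⊑ left (F r) →
                         HorizontalSide (F r) q → HorizontalSide (F p) q → ⊥
  corner-on-horizontal r p {_ , y} r≢p lp⊑lr onr onp =
    cond1 r p r≢p (left (F r) , y) (inj₁ Eq.refl , horizontal-height (F r) onr)
      (onHorizontal (F p) (horizontal-height (F p) onp)
        (lp⊑lr , ⊑-trans (proj₁ (horizontal-span (F r) onr)) (proj₂ (horizontal-span (F p) onp))))

  horizontal-sides-disjoint : ∀ r p {q} → r ≢ p → HorizontalSide (F r) q → HorizontalSide (F p) q → ⊥
  horizontal-sides-disjoint r p r≢p onr onp with ⊑-total (left (F p)) (left (F r))
  ... | inj₁ lp⊑lr = corner-on-horizontal r p r≢p lp⊑lr onr onp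
  ... | inj₂ lr⊑lp = corner-on-horizontal p r (≢-sym r≢p) lr⊑lp onp onr

  right-side-crosses : ∀ r p → r ≢ p → Intersect (F r) (F p) → right (F p) ⊑ right (F r) →
                       Meets (RightSide (F p)) (TopSide (F r)) × Meets (RightSide (F p)) (BottomSide (F r))
  right-side-crosses r p r≢p (q , onr , onp) rp⊑rr = via-p onp
    where
    p≢r = ≢-sym r≢p
    -- F r's right side can meet F p's top only at F p's top-right corner, against (1)
    top-right-corner : Meets (RightSide (F r)) (TopSide (F p)) → ⊥
    top-right-corner (t , (t₁≈rr , t₂∈r) , (t₂≈tp , t₁∈p)) =
      cond1 p r p≢r t
        (inj₂ (⊑-antisym (proj₂ t₁∈p) (⊑-trans rp⊑rr (≈⇒⊑ (Eq.sym t₁≈rr)))) , inj₂ t₂≈tp)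
        (inj₂ (inj₁ (t₁≈rr , t₂∈r)))
    via-r : HorizontalSide (F p) q → OnFrame (F r) q → ⊥
    via-r _ (inj₁ onLr) = cond2 r p r≢p (q , onLr , onp)
    via-r _ (inj₂ (inj₁ onRr)) = top-right-corner (proj₁ (cond3 r p r≢p (q , onRr , onp)))
    via-r onHp (inj₂ (inj₂ onHr)) = horizontal-sides-disjoint r p r≢p onHr onHp
    via-p : OnFrame (F p) q →
            Meets (RightSide (F p)) (TopSide (F r)) × Meets (RightSide (F p)) (BottomSide (F r))
    via-p (inj₁ onLp) = ⊥-elim (cond2 p r p≢r (q , onLp , onr))
    via-p (inj₂ (inj₁ onRp)) = cond3 p r p≢r (q , onRp , onr)
    via-p (inj₂ (inj₂ onHp)) = ⊥-elim (via-r onHp onr)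

  lower-left-inside : ∀ r p → r ≢ p → Intersect (F r) (F p) → right (F p) ⊑ right (F r) →
                      InRegion (F p) (left (F r) , bottom (F r))
  lower-left-inside r p r≢p meet rp⊑rr with right-side-crosses r p r≢p meet rp⊑rr
  ... | (_ , (u₁≈rp , u₂∈p) , (u₂≈tr , u₁∈r)) , (_ , (_ , w₂∈p) , (w₂≈br , _)) =
    (lp⊑lr , ⊑-trans (proj₁ u₁∈r) (≈⇒⊑ u₁≈rp)) ,
    (⊑-trans (proj₁ w₂∈p) (≈⇒⊑ w₂≈br) , ⊑-trans (≈⇒⊑ (Eq.sym w₂≈br)) (proj₂ w₂∈p))
    where
    -- otherwise the left side of F p would cross the top of F r, against (2)
    lp⊑lr : left (F p) ⊑ left (F r)
    lp⊑lr with <-or-⊒ (left (F r)) (left (F p))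
    ... | inj₂ lp⊑lr = lp⊑lr
    ... | inj₁ lr<lp = ⊥-elim (cond2 p r (≢-sym r≢p)
          (_ , (Eq.refl , (⊑-trans (proj₁ u₂∈p) (≈⇒⊑ u₂≈tr) , ⊑-trans (≈⇒⊑ (Eq.sym u₂≈tr)) (proj₂ u₂∈p))) ,
               onTop (F r) (<⇒⊑ lr<lp , ⊑-trans (left⊑right (F p)) (⊑-trans (≈⇒⊑ (Eq.sym u₁≈rp)) (proj₂ u₁∈r)))))

-- An induced cycle C of length 3 + m, listed as cyc, in a restricted
-- representation F.  A vertex x of C "qualifies" if ContainsNonNbrs F m cyc x.

module InducedCycle {c ℓ₁ ℓ₂} (O : StrictTotalOrder c ℓ₁ ℓ₂) {n : ℕ}
                    (F : Fin n → FrameDefs.Frame O) (res : FrameDefs.Restricted O F)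
                    (m : ℕ) (cyc : Fin (3 + m) → Fin n) (ic : FrameDefs.IsInducedCycle O F m cyc) where
  open import Data.Nat using (_≤_; _<_; _%_; _≤?_; z≤n; s≤s; z<s)
  open import Data.Nat.Properties using (<⇒≤; ≤-refl; ≤-trans; ≤-pred; m≤n⇒m≤1+n; m≤n⇒m<n∨m≡n)
    renaming (_≟_ to _≟ℕ_)
  open import Relation.Binary.Properties.StrictTotalOrder O using (totalOrder)
  open import Data.List.Extrema totalOrder using (argmax; f[xs]≤f[argmax])
  open FrameDefs O
  open FrameGeometry O
  open RestrictedFrames O F res
  open IsInducedCycle ic
  open CyclicShift {2 + m}
  open Interval

  X : Fin (3 + m) → Frame
  X i = F (cyc i)

  adjacent⇒cycNext : ∀ i j → Adj F (cyc i) (cyc j) → CycNext F i j ⊎ CycNext F j i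
  adjacent⇒cycNext i j = Equivalence.to (induced i j)

  cycNext⇒adjacent : ∀ i j → CycNext F i j ⊎ CycNext F j i → Adj F (cyc i) (cyc j)
  cycNext⇒adjacent i j = Equivalence.from (induced i j)

  cycNext⇒next : ∀ i j → CycNext F i j → j ≡ i ⊕ 1
  cycNext⇒next i j cn = toℕ-injective (trans cn (sym (toℕ-⊕ i 1)))

  next⇒cycNext : ∀ i j → i ⊕ 1 ≡ j → CycNext F i j
  next⇒cycNext i j i⊕1≡j = trans (cong toℕ (sym i⊕1≡j)) (toℕ-⊕ i 1)

  adjacent-sym : ∀ {a b} → Adj F a b → Adj F b a
  adjacent-sym {a} {b} (a≢b , meet) = ≢-sym a≢b , intersect-sym {F a} {F b} meet

  next-adjacent : ∀ i → Adj F (cyc i) (cyc (i ⊕ 1))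
  next-adjacent i = cycNext⇒adjacent i (i ⊕ 1) (inj₁ (next⇒cycNext i (i ⊕ 1) refl))

  consecutive : ∀ x k → Intersect (X (x ⊕ k)) (X (x ⊕ suc k))
  consecutive x k = subst (λ y → Intersect (X (x ⊕ k)) (X y)) (⊕-suc x k) (proj₂ (next-adjacent (x ⊕ k)))

  far-disjoint : ∀ x k → 2 ≤ k → k ≤ suc m → ¬ Intersect (X x) (X (x ⊕ k))
  far-disjoint x k@(suc (suc _)) (s≤s (s≤s z≤n)) k≤1+m meet =
    [ (λ forward → k≢1 (⊕-injective x k<3+m (s≤s (s≤s z≤n)) (cycNext⇒next x (x ⊕ k) forward)))
    , (λ backward → 0≢1+k (⊕-injective x z<s 1+k<3+m
                      (trans (⊕-identityʳ x) (trans (cycNext⇒next (x ⊕ k) x backward) (⊕-suc x k)))))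
    ]′ (adjacent⇒cycNext x (x ⊕ k) (distinct-vertices , meet))
    where
    -- a common point would make x ⊕ k a cyclic neighbour of x, i.e. k ≡ 1 or k + 1 ≡ 0 modulo 3 + m
    1+k<3+m : suc k < 3 + m
    1+k<3+m = s≤s (s≤s k≤1+m)
    k<3+m : k < 3 + m
    k<3+m = <⇒≤ 1+k<3+m
    k≢1 : k ≢ 1
    k≢1 ()
    0≢1+k : 0 ≢ suc k
    0≢1+k ()
    distinct-vertices : cyc x ≢ cyc (x ⊕ k)
    distinct-vertices e with ⊕-injective x z<s k<3+m (trans (⊕-identityʳ x) (distinct x (x ⊕ k) e))
    ... | ()

  non-neighbour-shift : ∀ x j → ¬ ClosedNbr F (cyc x) (cyc j) → ∃ λ k → 2 ≤ k × k ≤ suc m × x ⊕ k ≡ j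
  non-neighbour-shift x j away = classify (offset x j) (offset<N x j) (⊕-offset x j)
    where
    -- shifts 0, 1 and 2 + m reach x itself, its successor and its predecessor
    classify : ∀ k → k < 3 + m → x ⊕ k ≡ j → ∃ λ k → 2 ≤ k × k ≤ suc m × x ⊕ k ≡ j
    classify 0 _ x⊕0≡j = ⊥-elim (away (inj₁ (cong cyc (sym (trans (sym (⊕-identityʳ x)) x⊕0≡j)))))
    classify 1 _ x⊕1≡j = ⊥-elim (away (inj₂ (cycNext⇒adjacent x j (inj₁ (next⇒cycNext x j x⊕1≡j)))))
    classify (suc (suc k)) k<3+m x⊕k≡j with m≤n⇒m<n∨m≡n (≤-pred k<3+m)
    ... | inj₁ k<2+m = suc (suc k) , s≤s (s≤s z≤n) , ≤-pred k<2+m , x⊕k≡j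
    ... | inj₂ refl = ⊥-elim (away (inj₂ (cycNext⇒adjacent x j
                        (inj₂ (next⇒cycNext j x (subst (λ y → y ⊕ 1 ≡ x) x⊕k≡j (⊕-pred x)))))))

  qualifies-if-far-contained : ∀ x → (∀ k → 2 ≤ k → k ≤ suc m → Contains (X x) (X (x ⊕ k))) →
                               ContainsNonNbrs F m cyc x
  qualifies-if-far-contained x far j away with non-neighbour-shift x j away
  ... | k , 2≤k , k≤1+m , x⊕k≡j = subst (λ y → Contains (X x) (X y)) x⊕k≡j (far k 2≤k k≤1+m)

  spread-forward : ∀ x → Contains (X x) (X (x ⊕ 2)) → ContainsNonNbrs F m cyc x
  spread-forward x base = qualifies-if-far-contained x
    (interval-up (λ k → Contains (X x) (X (x ⊕ k))) base
      (λ {k} 2≤k k<1+m held → contains-along (X x) (X (x ⊕ k)) (X (x ⊕ suc k)) held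
                                 (consecutive x k) (far-disjoint x (suc k) (m≤n⇒m≤1+n 2≤k) k<1+m)))

  spread-backward : ∀ x → Contains (X x) (X (x ⊕ suc m)) → ContainsNonNbrs F m cyc x
  spread-backward x base = qualifies-if-far-contained x
    (interval-down (λ k → Contains (X x) (X (x ⊕ k))) base
      (λ {k} 2≤k k<1+m held → contains-along (X x) (X (x ⊕ suc k)) (X (x ⊕ k)) held
                                 (intersect-sym {X (x ⊕ k)} {X (x ⊕ suc k)} (consecutive x k))
                                 (far-disjoint x k 2≤k (<⇒≤ k<1+m))))

  outside-closed-nbr : ∀ a b → cyc b ≢ cyc a → ¬ CycNext F a b → ¬ CycNext F b a →
                       ¬ ClosedNbr F (cyc a) (cyc b)
  outside-closed-nbr a b b≢a _ _ (inj₁ b≡a) = b≢a b≡a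
  outside-closed-nbr a b _ ¬ab ¬ba (inj₂ adj) = [ ¬ab , ¬ba ]′ (adjacent⇒cycNext a b adj)

  -- two qualifying vertices are adjacent: otherwise their frames would contain each other
  qualifiers-adjacent : ∀ i j → cyc j ≢ cyc i → ContainsNonNbrs F m cyc i →
                        ContainsNonNbrs F m cyc j → Adj F (cyc i) (cyc j)
  qualifiers-adjacent i j j≢i qi qj
    with toℕ j ≟ℕ (toℕ i + 1) % (3 + m) | toℕ i ≟ℕ (toℕ j + 1) % (3 + m)
  ... | yes i→j | _ = cycNext⇒adjacent i j (inj₁ i→j)
  ... | no _ | yes j→i = cycNext⇒adjacent i j (inj₂ j→i)
  ... | no ¬i→j | no ¬j→i = ⊥-elim (contains-asym (X i) (X j)
          (qi j (outside-closed-nbr i j j≢i ¬i→j ¬j→i))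
          (qj i (outside-closed-nbr j i (≢-sym j≢i) ¬j→i ¬i→j)))

  rightmost : ∃ λ r → ∀ j → right (X j) ⊑ right (X r)
  rightmost = r , λ j → All.lookup below-r (∈-allFin j)
    where
    r : Fin (3 + m)
    r = argmax (right ∘ X) zero (allFin (3 + m))
    below-r : All.All (λ j → right (X j) ⊑ right (X r)) (allFin (3 + m))
    below-r = f[xs]≤f[argmax] {f = right ∘ X} zero (allFin (3 + m))

  -- In a cycle of length ≥ 4 the predecessor p and successor s of the rightmost
  -- vertex r are non-adjacent, and both regions contain the lower-left corner of
  -- F r; so one of F p, F s contains the other, and the outer one qualifies.
  qualifier-near-rightmost : 1 ≤ m → ∀ r → (∀ j → right (X j) ⊑ right (X r)) →
                             ∃ λ i → ContainsNonNbrs F m cyc i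
  qualifier-near-rightmost 1≤m r r-max =
    [ p-outer , s-outer ]′ (nested (X p) (X s) p∩s=∅ (corner-inside p (adjacent-sym p→r)) (corner-inside s r→s))
    where
    p s : Fin (3 + m)
    p = r ⊕ suc (suc m)
    s = r ⊕ 1
    p→r : Adj F (cyc p) (cyc r)
    p→r = subst (λ y → Adj F (cyc p) (cyc y)) (⊕-pred r) (next-adjacent p)
    r→s : Adj F (cyc r) (cyc s)
    r→s = next-adjacent r
    corner-inside : ∀ q → Adj F (cyc r) (cyc q) → InRegion (X q) (left (X r) , bottom (X r))
    corner-inside q (r≢q , meet) = lower-left-inside (cyc r) (cyc q) r≢q meet (r-max q)
    s≡p⊕2 : s ≡ p ⊕ 2
    s≡p⊕2 = sym (trans (sym (⊕-assoc p 1 1)) (cong (_⊕ 1) (⊕-pred r)))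
    p≡s⊕1+m : p ≡ s ⊕ suc m
    p≡s⊕1+m = sym (⊕-assoc r 1 (suc m))
    p∩s=∅ : ¬ Intersect (X p) (X s)
    p∩s=∅ = subst (λ y → ¬ Intersect (X p) (X y)) (sym s≡p⊕2) (far-disjoint p 2 ≤-refl (s≤s 1≤m))
    p-outer : Contains (X p) (X s) → ∃ λ i → ContainsNonNbrs F m cyc i
    p-outer p⊇s = p , spread-forward p (subst (λ y → Contains (X p) (X y)) s≡p⊕2 p⊇s)
    s-outer : Contains (X s) (X p) → ∃ λ i → ContainsNonNbrs F m cyc i
    s-outer s⊇p = s , spread-backward s (subst (λ y → Contains (X s) (X y)) p≡s⊕1+m s⊇p)

  -- some vertex qualifies; in a triangle (m = 0) there are no far shifts at all
  qualifier-exists : ∃ λ i → ContainsNonNbrs F m cyc i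
  qualifier-exists with 1 ≤? m
  ... | yes 1≤m = qualifier-near-rightmost 1≤m (proj₁ rightmost) (proj₂ rightmost)
  ... | no m≱1 = zero , qualifies-if-far-contained zero
                          (λ k 2≤k k≤1+m → ⊥-elim (m≱1 (≤-pred (≤-trans 2≤k k≤1+m))))

lemma3 : ∀ {c ℓ₁ ℓ₂} (O : StrictTotalOrder c ℓ₁ ℓ₂) → let open FrameDefs O in
         (n : ℕ) (F : Fin n → Frame) → Restricted F →
         (m : ℕ) (cyc : Fin (3 + m) → Fin n) → IsInducedCycle F m cyc →
         ∃ λ i → ContainsNonNbrs F m cyc i ×
           (∀ j → cyc j ≢ cyc i → ContainsNonNbrs F m cyc j → Adj F (cyc i) (cyc j))
lemma3 O _ F res m cyc ic =
  let (i , i-qualifies) = qualifier-exists in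
  i , i-qualifies , λ j j≢i j-qualifies → qualifiers-adjacent i j j≢i i-qualifies j-qualifies
  where open InducedCycle O F res m cyc ic
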